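{- Let $G=(V,E)$ be a finite tree, fix a vertex $i\in V$, and let $\phi:V\to\mathbb{R}_{\ge 0}$ be defined as below. Then for every starting vertex $j\in V$, the path $x_0=j,x_1,x_2,\dots$ produced by the descent rule (at each step $x_{k+1}$ is a neighbor of $x_k$ at which $\phi$ is minimal among all neighbors of $x_k$, continuing until $x_k=i$) is the shortest path from $j$ to $i$ in $G$, i.e. it has length equal to the graph distance $d(j,i)$, regardless of how ties are broken.
   Context: $L=D-A$ is the Laplacian matrix of $G$ ($D$ diagonal with $D_{vv}=\deg_G(v)$, $A$ the adjacency matrix). Let $C_1,\dots,C_m$ be the connected components of $G-i$ (the graph with $i$ and its incident edges deleted), and let $L_{C_k}$ denote the principal submatrix of $L$ indexed by the vertices of $C_k$ (with degrees taken in $G$). The function $\phi$ is defined by $\phi(i)=0$ and, on each $C_k$, $\phi$ equals a strictly positive eigenvector of $L_{C_k}$ associated with its smallest eigenvalue (this eigenvalue is positive and simple, and such a positive eigenvector exists and is unique up to positive scaling). -}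

module Defs where

open import Algebra.Bundles.Raw using (RawMonoid)
import Algebra.Definitions.RawMonoid as RawMonoidDefs
open import Data.Bool using (if_then_else_)
open import Data.Fin using (Fin; zero; suc; fromℕ; inject₁; punchIn)
import Data.Fin as Fin
open import Data.Fin.Subset using (Subset; inside; outside; ∣_∣; _∈_)
import Data.Integer as ℤ
open import Data.Nat using (ℕ; zero; suc)
import Data.Nat as ℕ
import Data.Nat.Properties as ℕₚ
open import Data.Product using (∃-syntax; _×_; _,_)
open import Data.Rational using (ℚ; 0ℚ; 1ℚ; ½)
import Data.Rational as ℚ
import Data.Rational.Properties as ℚₚ
open import Data.Rational.Solver using (module +-*-Solver)
open import Data.Vec using (Vec; []; _∷_; lookup; tabulate; map)
open import Data.Vec.Functional using (Vector)
open import Function using (_∘_; _⇔_; Injective)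
open import Level using (0ℓ)
open import Relation.Binary using (Rel; Decidable; Symmetric; Irreflexive)
open import Relation.Binary.PropositionalEquality
  using (_≡_; _≢_; refl; sym; trans; cong; cong₂; subst)
open import Relation.Nullary using (¬_; does)

-- ℝ is the type of Cauchy sequences of rationals, to be read up to `_≃_`.

IsCauchy : (ℕ → ℚ) → Set
IsCauchy s = ∀ ε → 0ℚ ℚ.< ε →
  ∃[ N ] ∀ m n → N ℕ.≤ m → N ℕ.≤ n → ℚ.∣ s m ℚ.- s n ∣ ℚ.< ε

record ℝ : Set where
  constructor mkℝ
  field
    seq    : ℕ → ℚ
    cauchy : IsCauchy seq

open ℝ public

infix  4 _≃_ _<_ _≤_
infixl 6 _+_ _-_
infixl 7 _*_
infix  8 -_

_≃_ : Rel ℝ 0ℓ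
x ≃ y = ∀ ε → 0ℚ ℚ.< ε →
  ∃[ N ] ∀ n → N ℕ.≤ n → ℚ.∣ seq x n ℚ.- seq y n ∣ ℚ.< ε

_<_ : Rel ℝ 0ℓ
x < y = ∃[ ε ] 0ℚ ℚ.< ε × ∃[ N ] ∀ n → N ℕ.≤ n → seq x n ℚ.+ ε ℚ.< seq y n

_≤_ : Rel ℝ 0ℓ
x ≤ y = ¬ (y < x)

fromℚ : ℚ → ℝ
fromℚ q = mkℝ (λ _ → q) λ ε ε>0 →
  0 , λ _ _ _ _ → subst (ℚ._< ε) (sym (cong ℚ.∣_∣ (ℚₚ.+-inverseʳ q))) ε>0

fromℕ′ : ℕ → ℝ
fromℕ′ n = fromℚ (ℤ.+ n ℚ./ 1)

0ℝ 1ℝ : ℝ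
0ℝ = fromℚ 0ℚ
1ℝ = fromℚ 1ℚ

private
  half>0 : ∀ ε → 0ℚ ℚ.< ε → 0ℚ ℚ.< ½ ℚ.* ε
  half>0 ε ε>0 = ℚₚ.*-monoʳ-<-pos ½ ε>0

  half+half : ∀ ε → ½ ℚ.* ε ℚ.+ ½ ℚ.* ε ≡ ε
  half+half ε = trans (sym (ℚₚ.*-distribʳ-+ ε ½ ½)) (ℚₚ.*-identityˡ ε)

_+_ : ℝ → ℝ → ℝ
seq    (x + y) n = seq x n ℚ.+ seq y n
cauchy (x + y) ε ε>0 =
  let (M , p) = cauchy x (½ ℚ.* ε) (half>0 ε ε>0)
      (N , q) = cauchy y (½ ℚ.* ε) (half>0 ε ε>0)
  in M ℕ.⊔ N , λ m n M⊔N≤m M⊔N≤n →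
    let open ℚₚ.≤-Reasoning in begin-strict
    ℚ.∣ (seq x m ℚ.+ seq y m) ℚ.- (seq x n ℚ.+ seq y n) ∣
      ≡⟨ cong ℚ.∣_∣ (rearrange (seq x m) (seq y m) (seq x n) (seq y n)) ⟩
    ℚ.∣ (seq x m ℚ.- seq x n) ℚ.+ (seq y m ℚ.- seq y n) ∣
      ≤⟨ ℚₚ.∣p+q∣≤∣p∣+∣q∣ (seq x m ℚ.- seq x n) (seq y m ℚ.- seq y n) ⟩
    ℚ.∣ seq x m ℚ.- seq x n ∣ ℚ.+ ℚ.∣ seq y m ℚ.- seq y n ∣
      <⟨ ℚₚ.+-mono-<
           (p m n (ℕₚ.m⊔n≤o⇒m≤o M N M⊔N≤m) (ℕₚ.m⊔n≤o⇒m≤o M N M⊔N≤n))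
           (q m n (ℕₚ.m⊔n≤o⇒n≤o M N M⊔N≤m) (ℕₚ.m⊔n≤o⇒n≤o M N M⊔N≤n)) ⟩
    ½ ℚ.* ε ℚ.+ ½ ℚ.* ε
      ≡⟨ half+half ε ⟩
    ε ∎
  where
  rearrange : ∀ a b c d →
    (a ℚ.+ b) ℚ.- (c ℚ.+ d) ≡ (a ℚ.- c) ℚ.+ (b ℚ.- d)
  rearrange = solve 4 (λ a b c d →
    ((a :+ b) :- (c :+ d)) := ((a :- c) :+ (b :- d))) refl
    where open +-*-Solver

-_ : ℝ → ℝ
seq    (- x) n = ℚ.- seq x n
cauchy (- x) ε ε>0 =
  let (N , p) = cauchy x ε ε>0
  in N , λ m n N≤m N≤n → subst (ℚ._< ε)
    (trans (sym (ℚₚ.∣-p∣≡∣p∣ (seq x m ℚ.- seq x n)))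
           (cong ℚ.∣_∣ (ℚₚ.neg-distrib-+ (seq x m) (ℚ.- seq x n))))
    (p m n N≤m N≤n)

_-_ : ℝ → ℝ → ℝ
x - y = x + (- y)

private
  bounded : ∀ x → ∃[ B ] 0ℚ ℚ.< B × ∃[ N ] ∀ n → N ℕ.≤ n → ℚ.∣ seq x n ∣ ℚ.≤ B
  bounded x = let (N , p) = cauchy x 1ℚ (ℚₚ.positive⁻¹ 1ℚ) in
    1ℚ ℚ.+ ℚ.∣ seq x N ∣ ,
    ℚₚ.+-mono-<-≤ (ℚₚ.positive⁻¹ 1ℚ) (ℚₚ.0≤∣p∣ (seq x N)) ,
    N , λ n N≤n → let open ℚₚ.≤-Reasoning in begin
      ℚ.∣ seq x n ∣
        ≡⟨ cong ℚ.∣_∣ (split (seq x n) (seq x N)) ⟩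
      ℚ.∣ (seq x n ℚ.- seq x N) ℚ.+ seq x N ∣
        ≤⟨ ℚₚ.∣p+q∣≤∣p∣+∣q∣ (seq x n ℚ.- seq x N) (seq x N) ⟩
      ℚ.∣ seq x n ℚ.- seq x N ∣ ℚ.+ ℚ.∣ seq x N ∣
        ≤⟨ ℚₚ.+-monoˡ-≤ ℚ.∣ seq x N ∣ (ℚₚ.<⇒≤ (p n N N≤n ℕₚ.≤-refl)) ⟩
      1ℚ ℚ.+ ℚ.∣ seq x N ∣ ∎
    where
    split : ∀ a b → a ≡ (a ℚ.- b) ℚ.+ b
    split = solve 2 (λ a b → a := ((a :- b) :+ b)) refl
      where open +-*-Solver

  scale : ∀ B ε → 0ℚ ℚ.< B → 0ℚ ℚ.< ε → ∃[ δ ] 0ℚ ℚ.< δ × B ℚ.* δ ≡ ε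
  scale B ε B>0 ε>0 = δ , δ>0 , Bδ≡ε
    where
    instance
      B-pos : ℚ.Positive B
      B-pos = ℚ.positive B>0

      B-nonZero : ℚ.NonZero B
      B-nonZero = ℚₚ.pos⇒nonZero B

      1/B-pos : ℚ.Positive (ℚ.1/ B)
      1/B-pos = ℚₚ.1/pos⇒pos B

    δ = ℚ.1/ B ℚ.* ε

    δ>0 : 0ℚ ℚ.< δ
    δ>0 = subst (ℚ._< δ) (ℚₚ.*-zeroʳ (ℚ.1/ B)) (ℚₚ.*-monoʳ-<-pos (ℚ.1/ B) ε>0)

    Bδ≡ε : B ℚ.* δ ≡ ε
    Bδ≡ε = trans (sym (ℚₚ.*-assoc B (ℚ.1/ B) ε))
      (trans (cong (ℚ._* ε) (ℚₚ.*-inverseʳ B)) (ℚₚ.*-identityˡ ε))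

  *-bound : ∀ {B δ} → 0ℚ ℚ.< B → ∀ a b →
    ℚ.∣ a ∣ ℚ.≤ B → ℚ.∣ b ∣ ℚ.< δ → ℚ.∣ a ℚ.* b ∣ ℚ.< B ℚ.* δ
  *-bound {B} {δ} B>0 a b ∣a∣≤B ∣b∣<δ = begin-strict
    ℚ.∣ a ℚ.* b ∣           ≡⟨ ℚₚ.∣p*q∣≡∣p∣*∣q∣ a b ⟩
    ℚ.∣ a ∣ ℚ.* ℚ.∣ b ∣
      ≤⟨ ℚₚ.*-monoʳ-≤-nonNeg ℚ.∣ b ∣ {{ℚ.nonNegative (ℚₚ.0≤∣p∣ b)}} ∣a∣≤B ⟩
    B ℚ.* ℚ.∣ b ∣
      <⟨ ℚₚ.*-monoʳ-<-pos B {{ℚ.positive B>0}} ∣b∣<δ ⟩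
    B ℚ.* δ ∎
    where open ℚₚ.≤-Reasoning

_*_ : ℝ → ℝ → ℝ
seq    (x * y) n = seq x n ℚ.* seq y n
cauchy (x * y) ε ε>0 =
  let (A , A>0 , K , a) = bounded x
      (B , B>0 , L , b) = bounded y
      (α , α>0 , Aα≡ε/2) = scale A (½ ℚ.* ε) A>0 (half>0 ε ε>0)
      (β , β>0 , Bβ≡ε/2) = scale B (½ ℚ.* ε) B>0 (half>0 ε ε>0)
      (M , p) = cauchy x β β>0
      (N , q) = cauchy y α α>0
      maxˡ = ℕₚ.m⊔n≤o⇒m≤o
      maxʳ = ℕₚ.m⊔n≤o⇒n≤o
  in (K ℕ.⊔ L) ℕ.⊔ (M ℕ.⊔ N) , λ m n ≤m ≤n →
    let KL≤m = maxˡ (K ℕ.⊔ L) (M ℕ.⊔ N) ≤m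
        KL≤n = maxˡ (K ℕ.⊔ L) (M ℕ.⊔ N) ≤n
        MN≤m = maxʳ (K ℕ.⊔ L) (M ℕ.⊔ N) ≤m
        MN≤n = maxʳ (K ℕ.⊔ L) (M ℕ.⊔ N) ≤n
        open ℚₚ.≤-Reasoning in begin-strict
    ℚ.∣ seq x m ℚ.* seq y m ℚ.- seq x n ℚ.* seq y n ∣
      ≡⟨ cong ℚ.∣_∣ (rearrange (seq x m) (seq y m) (seq x n) (seq y n)) ⟩
    ℚ.∣ seq x m ℚ.* (seq y m ℚ.- seq y n) ℚ.+ seq y n ℚ.* (seq x m ℚ.- seq x n) ∣
      ≤⟨ ℚₚ.∣p+q∣≤∣p∣+∣q∣ (seq x m ℚ.* (seq y m ℚ.- seq y n))
                           (seq y n ℚ.* (seq x m ℚ.- seq x n)) ⟩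
    ℚ.∣ seq x m ℚ.* (seq y m ℚ.- seq y n) ∣ ℚ.+
    ℚ.∣ seq y n ℚ.* (seq x m ℚ.- seq x n) ∣
      <⟨ ℚₚ.+-mono-<
           (*-bound A>0 (seq x m) (seq y m ℚ.- seq y n)
             (a m (maxˡ K L KL≤m)) (q m n (maxʳ M N MN≤m) (maxʳ M N MN≤n)))
           (*-bound B>0 (seq y n) (seq x m ℚ.- seq x n)
             (b n (maxʳ K L KL≤n)) (p m n (maxˡ M N MN≤m) (maxˡ M N MN≤n))) ⟩
    A ℚ.* α ℚ.+ B ℚ.* β
      ≡⟨ cong₂ ℚ._+_ Aα≡ε/2 Bβ≡ε/2 ⟩
    ½ ℚ.* ε ℚ.+ ½ ℚ.* ε
      ≡⟨ half+half ε ⟩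
    ε ∎
  where
  rearrange : ∀ a b c d →
    a ℚ.* b ℚ.- c ℚ.* d ≡ a ℚ.* (b ℚ.- d) ℚ.+ d ℚ.* (a ℚ.- c)
  rearrange = solve 4 (λ a b c d →
    ((a :* b) :- (c :* d)) := ((a :* (b :- d)) :+ (d :* (a :- c)))) refl
    where open +-*-Solver

+-0-rawMonoid : RawMonoid 0ℓ 0ℓ
+-0-rawMonoid = record { Carrier = ℝ ; _≈_ = _≃_ ; _∙_ = _+_ ; ε = 0ℝ }

open RawMonoidDefs +-0-rawMonoid public using (sum)

Matrix : ℕ → Set
Matrix n = Fin n → Fin n → ℝ

infixl 7 _*ᵥ_

_*ᵥ_ : ∀ {n} → Matrix n → Vector ℝ n → Vector ℝ n
(M *ᵥ x) a = sum λ b → M a b * x b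

submatrix : ∀ {m n} → Matrix n → (Fin m → Fin n) → Matrix m
submatrix M e a b = M (e a) (e b)

IsEigenvector : ∀ {n} → Matrix n → ℝ → Vector ℝ n → Set
IsEigenvector M μ x =
  ¬ (∀ a → x a ≃ 0ℝ) × (∀ a → (M *ᵥ x) a ≃ μ * x a)

IsEigenvalue : ∀ {n} → Matrix n → ℝ → Set
IsEigenvalue M μ = ∃[ x ] IsEigenvector M μ x

IsSmallestEigenvalue : ∀ {n} → Matrix n → ℝ → Set
IsSmallestEigenvalue M μ =
  IsEigenvalue M μ × (∀ ν → IsEigenvalue M ν → μ ≤ ν)

record Graph (n : ℕ) : Set₁ where
  field
    Adj    : Rel (Fin n) 0ℓ
    adj?   : Decidable Adj
    symm   : Symmetric Adj
    irrefl : Irreflexive _≡_ Adj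

module _ {n} (G : Graph n) where
  open Graph G

  infixr 5 _∷_

  data Walk : Fin n → Fin n → ℕ → Set where
    []  : ∀ {u} → Walk u u 0
    _∷_ : ∀ {u v w ℓ} → Adj u v → Walk v w ℓ → Walk u w (suc ℓ)

  Reachable : Fin n → Fin n → Set
  Reachable u v = ∃[ ℓ ] Walk u v ℓ

  IsDistance : Fin n → Fin n → ℕ → Set
  IsDistance u v d = Walk u v d × (∀ ℓ → Walk u v ℓ → d ℕ.≤ ℓ)

  record Cycle : Set where
    field
      {k}      : ℕ
      vertex   : Fin (3 ℕ.+ k) → Fin n
      distinct : Injective _≡_ _≡_ vertex
      step     : ∀ a → Adj (vertex (inject₁ a)) (vertex (suc a))
      close    : Adj (vertex (fromℕ (2 ℕ.+ k))) (vertex zero)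

  IsTree : Set
  IsTree = (∀ u v → Reachable u v) × ¬ Cycle

  IsComponent : Subset n → Set
  IsComponent C = ∃[ u ] ∀ v → v ∈ C ⇔ Reachable u v

  degree : Fin n → ℕ
  degree v = ∣ tabulate (does ∘ adj? v) ∣

  degreeMatrix adjacencyMatrix laplacian : Matrix n
  degreeMatrix u v = if does (u Fin.≟ v) then fromℕ′ (degree u) else 0ℝ
  adjacencyMatrix u v = if does (adj? u v) then 1ℝ else 0ℝ
  laplacian u v = degreeMatrix u v - adjacencyMatrix u v

-- The vertex `a` of `G ∖ i` is the vertex `punchIn i a` of `G`.
infixl 6 _∖_

_∖_ : ∀ {n} → Graph (suc n) → Fin (suc n) → Graph n
G ∖ i = record
  { Adj    = λ a b → Adj (punchIn i a) (punchIn i b)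
  ; adj?   = λ a b → adj? (punchIn i a) (punchIn i b)
  ; symm   = symm
  ; irrefl = λ eq → irrefl (cong (punchIn i) eq)
  }
  where open Graph G

elements : ∀ {n} (p : Subset n) → Vec (Fin n) ∣ p ∣
elements []            = []
elements (inside  ∷ p) = zero ∷ map suc (elements p)
elements (outside ∷ p) = map suc (elements p)

module _ {n} (G : Graph (suc n)) (i : Fin (suc n)) where

  componentVertex : (C : Subset n) → Fin ∣ C ∣ → Fin (suc n)
  componentVertex C = punchIn i ∘ lookup (elements C)

  -- Degrees are taken in `G`, not in the component.
  componentLaplacian : (C : Subset n) → Matrix ∣ C ∣
  componentLaplacian C = submatrix (laplacian G) (componentVertex C)

  record IsPotential (φ : Fin (suc n) → ℝ) : Set where
    field
      root      : φ i ≃ 0ℝ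
      component : ∀ C → IsComponent (G ∖ i) C → ∃[ μ ]
        IsSmallestEigenvalue (componentLaplacian C) μ ×
        IsEigenvector (componentLaplacian C) μ (φ ∘ componentVertex C) ×
        (∀ a → 0ℝ < φ (componentVertex C a))

module _ {n} (G : Graph n) where
  open Graph G

  IsMinimalNeighbour : (Fin n → ℝ) → Fin n → Fin n → Set
  IsMinimalNeighbour φ v w = Adj v w × (∀ u → Adj v u → φ w ≤ φ u)

  -- A run stops on reaching `i`: later terms of `x` are unconstrained.
  IsDescent : (Fin n → ℝ) → (i j : Fin n) → (ℕ → Fin n) → Set
  IsDescent φ i j x =
    x 0 ≡ j × (∀ k → (∀ m → m ℕ.≤ k → x m ≢ i) →
                 IsMinimalNeighbour φ (x k) (x (suc k)))

  record IsShortestPath (u v : Fin n) (x : ℕ → Fin n) (ℓ : ℕ) : Set where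
    field
      start    : x 0 ≡ u
      end      : x ℓ ≡ v
      step     : ∀ k → k ℕ.< ℓ → Adj (x k) (x (suc k))
      shortest : IsDistance G u v ℓ

{-# OPTIONS --safe #-}
module Submission where

-- Root the tree at i. For v ≠ i with parent p, the eigenvector equation at v reads
--   φ v − φ p = μ φ v + Σ (φ c − φ v)   over the children c of v,
-- so, by induction from the leaves, φ v − φ p = μ S with S > 0 the sum of φ over
-- the subtree at v. When p = i the left-hand side is φ v > 0, hence μ > 0. Thus φ
-- strictly increases away from i, the parent is the only minimal neighbour, and
-- every step of a descent lowers the distance to i by one.

-- A parent is just a neighbour one step closer to `i`, so two facts that make the overview work
-- have to be proved: each vertex has at most one parent, and every edge joins a vertex to its
-- parent. A violation of either gives a path with ends of equal depth and no vertex closer to the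
-- root, which acyclicity excludes. The eigenvector equation is only given on a component of
-- `G ∖ i`. It extends to the full Laplacian row because `φ` vanishes at `i`, and one `μ` serves the
-- whole induction because the children of a vertex of the component lie in that component again.
-- Strict inequality in this `ℝ` carries a rational margin, so positivity is built from explicit
-- witnesses throughout, and `μ > 0` is obtained by cancelling a positive factor.

open import Defs
open import Algebra.Bundles using (CommutativeMonoid)
import Algebra.Properties.CommutativeMonoid.Sum as CommutativeMonoidSum
open import Data.Bool using (Bool; true; false; if_then_else_)
open import Data.Empty using (⊥)
open import Data.Fin using (Fin; zero; suc; fromℕ; inject₁; opposite; punchIn; punchOut)
import Data.Fin as Fin
import Data.Fin.Properties as Finₚ
open import Data.Fin.Subset using (Subset; inside; outside; ∣_∣; _∈_; _∉_)
import Data.Integer as ℤ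
import Data.Integer.Properties as ℤₚ
open import Data.Nat using (ℕ; zero; suc)
import Data.Nat as ℕ
import Data.Nat.Induction as ℕᵢ
import Data.Nat.Properties as ℕₚ
open import Data.Product using (_×_; _,_; ∃-syntax; proj₁; proj₂)
open import Data.Rational using (ℚ; 0ℚ; 1ℚ; ½)
import Data.Rational as ℚ
import Data.Rational.Properties as ℚₚ
open import Data.Rational.Solver using (module +-*-Solver)
import Data.Rational.Unnormalised as ℚᵘ
import Data.Rational.Unnormalised.Properties as ℚᵘₚ
open import Data.Sum using (_⊎_; inj₁; inj₂)
open import Data.Vec using (_∷_; lookup; tabulate; map; here; there)
import Data.Vec as Vec
open import Data.Vec.Functional using (Vector)
import Data.Vec.Functional as Vector
import Data.Vec.Properties as Vecₚ
open import Effect.Monad using (RawMonad)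
open import Function using (_∘_; mk⇔; Equivalence; Injective)
open import Level using (0ℓ)
open import Relation.Binary using (IsEquivalence; tri<; tri≈; tri>)
open import Relation.Binary.PropositionalEquality
  using (_≡_; _≢_; refl; sym; trans; cong; cong₂; subst; subst₂)
import Relation.Binary.Reasoning.Setoid as SetoidReasoning
open import Relation.Nullary using (¬_; Dec; yes; no; does; contradiction)
open import Relation.Nullary.Decidable
  using (_×-dec_; map′; dec-true; dec-false; ¬¬-excluded-middle)
open import Relation.Nullary.Negation using (¬¬-Monad; ¬¬-map)

-- Arithmetic and positivity of Cauchy reals

-- Comparing terms of the eta record ℝ means comparing their Cauchy proofs;
-- without eta, terms are compared, and arguments inferred, by head symbol.

record ℛ : Set where
  no-eta-equality
  constructor ⌜_⌝
  field
    real : ℝ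

open ℛ

at : ℛ → ℕ → ℚ
at x = seq (real x)

infixl 6 _⊕_ _⊖_
infixl 7 _⊛_
infix  8 ⊝_

0# : ℛ
real 0# = 0ℝ

_⊕_ _⊛_ _⊖_ : ℛ → ℛ → ℛ
real (x ⊕ y) = real x + real y
real (x ⊛ y) = real x * real y

⊝_ : ℛ → ℛ
real (⊝ x) = - real x

x ⊖ y = x ⊕ ⊝ y

infix 4 _≈_

record _≈_ (x y : ℛ) : Set where
  constructor ⟦_⟧
  field
    ≈⇒≃ : real x ≃ real y

record Positive (x : ℛ) : Set where
  constructor pos
  field
    0<x : 0ℝ < real x

½ε>0 : ∀ ε → 0ℚ ℚ.< ε → 0ℚ ℚ.< ½ ℚ.* ε
½ε>0 ε ε>0 = ℚₚ.*-monoʳ-<-pos ½ ε>0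

½ε+½ε≡ε : ∀ ε → ½ ℚ.* ε ℚ.+ ½ ℚ.* ε ≡ ε
½ε+½ε≡ε ε = trans (sym (ℚₚ.*-distribʳ-+ ε ½ ½)) (ℚₚ.*-identityˡ ε)

≈-pointwise : ∀ {x y} → (∀ n → at x n ≡ at y n) → x ≈ y
≈-pointwise {x} {y} x≡y = ⟦ (λ ε ε>0 → 0 , λ n _ → subst (ℚ._< ε)
  (sym (cong ℚ.∣_∣ (trans (cong (ℚ._- at y n) (x≡y n)) (ℚₚ.+-inverseʳ (at y n)))))
  ε>0) ⟧

≈-refl : ∀ {x} → x ≈ x
≈-refl = ≈-pointwise λ _ → refl

p≤∣p∣ : ∀ p → p ℚ.≤ ℚ.∣ p ∣
p≤∣p∣ p with ℚₚ.≤-total 0ℚ p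
... | inj₁ 0≤p = ℚₚ.≤-reflexive (sym (ℚₚ.0≤p⇒∣p∣≡p 0≤p))
... | inj₂ p≤0 = ℚₚ.≤-trans p≤0 (ℚₚ.0≤∣p∣ p)

∣p-q∣≡∣q-p∣ : ∀ p q → ℚ.∣ p ℚ.- q ∣ ≡ ℚ.∣ q ℚ.- p ∣
∣p-q∣≡∣q-p∣ p q = trans (sym (ℚₚ.∣-p∣≡∣p∣ (p ℚ.- q))) (cong ℚ.∣_∣
  (solve 2 (λ p q → :- (p :- q) := q :- p) refl p q))
  where open +-*-Solver

≈-sym : ∀ {x y} → x ≈ y → y ≈ x
≈-sym {x} {y} ⟦ x≃y ⟧ = ⟦ (λ ε ε>0 → let (N , p) = x≃y ε ε>0 in
  N , λ n N≤n → subst (ℚ._< ε) (∣p-q∣≡∣q-p∣ (at x n) (at y n)) (p n N≤n)) ⟧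

close-+ : ∀ {ε} a b c d → ℚ.∣ a ℚ.- b ∣ ℚ.< ½ ℚ.* ε → ℚ.∣ c ℚ.- d ∣ ℚ.< ½ ℚ.* ε →
  ℚ.∣ (a ℚ.+ c) ℚ.- (b ℚ.+ d) ∣ ℚ.< ε
close-+ {ε} a b c d a~b c~d = begin-strict
  ℚ.∣ (a ℚ.+ c) ℚ.- (b ℚ.+ d) ∣      ≡⟨ cong ℚ.∣_∣ (rearrange a b c d) ⟩
  ℚ.∣ (a ℚ.- b) ℚ.+ (c ℚ.- d) ∣      ≤⟨ ℚₚ.∣p+q∣≤∣p∣+∣q∣ (a ℚ.- b) (c ℚ.- d) ⟩
  ℚ.∣ a ℚ.- b ∣ ℚ.+ ℚ.∣ c ℚ.- d ∣    <⟨ ℚₚ.+-mono-< a~b c~d ⟩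
  ½ ℚ.* ε ℚ.+ ½ ℚ.* ε                ≡⟨ ½ε+½ε≡ε ε ⟩
  ε                                  ∎
  where
  open ℚₚ.≤-Reasoning
  rearrange : ∀ a b c d → (a ℚ.+ c) ℚ.- (b ℚ.+ d) ≡ (a ℚ.- b) ℚ.+ (c ℚ.- d)
  rearrange = solve 4 (λ a b c d → ((a :+ c) :- (b :+ d)) := ((a :- b) :+ (c :- d))) refl
    where open +-*-Solver

≈-trans : ∀ {x y z} → x ≈ y → y ≈ z → x ≈ z
≈-trans {x} {y} {z} ⟦ x≃y ⟧ ⟦ y≃z ⟧ = ⟦ (λ ε ε>0 →
  let (M , p) = x≃y (½ ℚ.* ε) (½ε>0 ε ε>0)
      (N , q) = y≃z (½ ℚ.* ε) (½ε>0 ε ε>0)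
  in M ℕ.⊔ N , λ n M⊔N≤n → subst (ℚ._< ε)
    (cong ℚ.∣_∣ (telescope (at x n) (at y n) (at z n)))
    (close-+ (at x n) (at y n) (at y n) (at z n)
      (p n (ℕₚ.m⊔n≤o⇒m≤o M N M⊔N≤n)) (q n (ℕₚ.m⊔n≤o⇒n≤o M N M⊔N≤n)))) ⟧
  where
  telescope : ∀ a b c → (a ℚ.+ b) ℚ.- (b ℚ.+ c) ≡ a ℚ.- c
  telescope = solve 3 (λ a b c → ((a :+ b) :- (b :+ c)) := (a :- c)) refl
    where open +-*-Solver

≈-isEquivalence : IsEquivalence _≈_
≈-isEquivalence = record { refl = ≈-refl ; sym = ≈-sym ; trans = ≈-trans }

⊕-cong : ∀ {x y u v} → x ≈ y → u ≈ v → x ⊕ u ≈ y ⊕ v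
⊕-cong {x} {y} {u} {v} ⟦ x≃y ⟧ ⟦ u≃v ⟧ = ⟦ (λ ε ε>0 →
  let (M , p) = x≃y (½ ℚ.* ε) (½ε>0 ε ε>0)
      (N , q) = u≃v (½ ℚ.* ε) (½ε>0 ε ε>0)
  in M ℕ.⊔ N , λ n M⊔N≤n → close-+ (at x n) (at y n) (at u n) (at v n)
      (p n (ℕₚ.m⊔n≤o⇒m≤o M N M⊔N≤n)) (q n (ℕₚ.m⊔n≤o⇒n≤o M N M⊔N≤n))) ⟧

⊝-cong : ∀ {x y} → x ≈ y → ⊝ x ≈ ⊝ y
⊝-cong {x} {y} ⟦ x≃y ⟧ = ⟦ (λ ε ε>0 → let (N , p) = x≃y ε ε>0 in
  N , λ n N≤n → subst (ℚ._< ε)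
    (trans (∣p-q∣≡∣q-p∣ (at x n) (at y n)) (cong ℚ.∣_∣ (flip (at x n) (at y n))))
    (p n N≤n)) ⟧
  where
  flip : ∀ a b → b ℚ.- a ≡ ℚ.- a ℚ.- ℚ.- b
  flip = solve 2 (λ a b → (b :- a) := ((:- a) :- (:- b))) refl
    where open +-*-Solver

⊕-identityˡ : ∀ x → 0# ⊕ x ≈ x
⊕-identityˡ x = ≈-pointwise λ n → ℚₚ.+-identityˡ (at x n)

⊕-0-commutativeMonoid : CommutativeMonoid 0ℓ 0ℓ
⊕-0-commutativeMonoid = record
  { Carrier = ℛ
  ; _≈_ = _≈_
  ; _∙_ = _⊕_
  ; ε = 0#
  ; isCommutativeMonoid = record
    { isMonoid = record
      { isSemigroup = record
        { isMagma = record { isEquivalence = ≈-isEquivalence ; ∙-cong = ⊕-cong }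
        ; assoc = λ x y z → ≈-pointwise λ n → ℚₚ.+-assoc (at x n) (at y n) (at z n)
        }
      ; identity = ⊕-identityˡ , λ x → ≈-pointwise λ n → ℚₚ.+-identityʳ (at x n)
      }
    ; comm = λ x y → ≈-pointwise λ n → ℚₚ.+-comm (at x n) (at y n)
    }
  }

module Σ = CommutativeMonoidSum ⊕-0-commutativeMonoid
module ≈-Reasoning = SetoidReasoning (CommutativeMonoid.setoid ⊕-0-commutativeMonoid)

-- Half of the margin `ε` absorbs the difference between `x` and `y`; the other half remains as the
-- margin of `y`.
Positive-resp-≈ : ∀ {x y} → x ≈ y → Positive x → Positive y
Positive-resp-≈ {x} {y} ⟦ x≃y ⟧ (pos (ε , ε>0 , M , p)) =
  let (N , q) = x≃y (½ ℚ.* ε) (½ε>0 ε ε>0)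
  in pos (½ ℚ.* ε , ½ε>0 ε ε>0 , M ℕ.⊔ N , λ n M⊔N≤n →
    let a = at x n
        b = at y n
    in begin-strict
    0ℚ ℚ.+ ½ ℚ.* ε                             ≡⟨ halve ε ⟩
    (0ℚ ℚ.+ ε) ℚ.- ½ ℚ.* ε
      <⟨ ℚₚ.+-monoˡ-< (ℚ.- (½ ℚ.* ε)) (p n (ℕₚ.m⊔n≤o⇒m≤o M N M⊔N≤n)) ⟩
    a ℚ.- ½ ℚ.* ε
      <⟨ ℚₚ.+-monoʳ-< a (ℚₚ.neg-antimono-<
           (ℚₚ.≤-<-trans (p≤∣p∣ (a ℚ.- b)) (q n (ℕₚ.m⊔n≤o⇒n≤o M N M⊔N≤n)))) ⟩
    a ℚ.- (a ℚ.- b)                            ≡⟨ cancel a b ⟩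
    b                                          ∎)
  where
  open ℚₚ.≤-Reasoning
  halve : ∀ ε → 0ℚ ℚ.+ ½ ℚ.* ε ≡ (0ℚ ℚ.+ ε) ℚ.- ½ ℚ.* ε
  halve = solve 1 (λ ε → (con 0ℚ :+ con ½ :* ε) := ((con 0ℚ :+ ε) :- con ½ :* ε)) refl
    where open +-*-Solver
  cancel : ∀ a b → a ℚ.- (a ℚ.- b) ≡ b
  cancel = solve 2 (λ a b → (a :- (a :- b)) := b) refl
    where open +-*-Solver

Positive-⊕ : ∀ {x y} → Positive x → Positive y → Positive (x ⊕ y)
Positive-⊕ {x} {y} (pos (ε , ε>0 , M , p)) (pos (δ , δ>0 , N , q)) =
  pos (ε ℚ.+ δ , ℚₚ.+-mono-< ε>0 δ>0 , M ℕ.⊔ N , λ n M⊔N≤n →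
    subst (ℚ._< at x n ℚ.+ at y n) (shuffle ε δ)
      (ℚₚ.+-mono-< (p n (ℕₚ.m⊔n≤o⇒m≤o M N M⊔N≤n)) (q n (ℕₚ.m⊔n≤o⇒n≤o M N M⊔N≤n))))
  where
  shuffle : ∀ ε δ → (0ℚ ℚ.+ ε) ℚ.+ (0ℚ ℚ.+ δ) ≡ 0ℚ ℚ.+ (ε ℚ.+ δ)
  shuffle = solve 2 (λ ε δ → ((con 0ℚ :+ ε) :+ (con 0ℚ :+ δ)) := (con 0ℚ :+ (ε :+ δ))) refl
    where open +-*-Solver

p*q>0 : ∀ {p q} → 0ℚ ℚ.< p → 0ℚ ℚ.< q → 0ℚ ℚ.< p ℚ.* q
p*q>0 {p} {q} p>0 q>0 =
  subst (ℚ._< p ℚ.* q) (ℚₚ.*-zeroʳ p) (ℚₚ.*-monoʳ-<-pos p {{ℚ.positive p>0}} q>0)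

Positive-⊛ : ∀ {x y} → Positive x → Positive y → Positive (x ⊛ y)
Positive-⊛ {x} {y} (pos (ε , ε>0 , M , p)) (pos (δ , δ>0 , N , q)) =
  pos (ε ℚ.* δ , p*q>0 ε>0 δ>0 , M ℕ.⊔ N , λ n M⊔N≤n →
    let a = at x n
        b = at y n
        ε<a = subst (ℚ._< a) (ℚₚ.+-identityˡ ε) (p n (ℕₚ.m⊔n≤o⇒m≤o M N M⊔N≤n))
        δ<b = subst (ℚ._< b) (ℚₚ.+-identityˡ δ) (q n (ℕₚ.m⊔n≤o⇒n≤o M N M⊔N≤n))
    in begin-strict
    0ℚ ℚ.+ ε ℚ.* δ  ≡⟨ ℚₚ.+-identityˡ (ε ℚ.* δ) ⟩
    ε ℚ.* δ         <⟨ ℚₚ.*-monoʳ-<-pos ε {{ℚ.positive ε>0}} δ<b ⟩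
    ε ℚ.* b         <⟨ ℚₚ.*-monoˡ-<-pos b {{ℚ.positive (ℚₚ.<-trans δ>0 δ<b)}} ε<a ⟩
    a ℚ.* b         ∎)
  where open ℚₚ.≤-Reasoning

eventually-bounded : ∀ x →
  ∃[ B ] 0ℚ ℚ.< B × ∃[ N ] ∀ n → N ℕ.≤ n → at x n ℚ.≤ B
eventually-bounded x = let (N , p) = cauchy (real x) 1ℚ (ℚₚ.positive⁻¹ 1ℚ) in
  1ℚ ℚ.+ ℚ.∣ at x N ∣ ,
  ℚₚ.+-mono-<-≤ (ℚₚ.positive⁻¹ 1ℚ) (ℚₚ.0≤∣p∣ (at x N)) ,
  N , λ n N≤n → begin
    at x n                                   ≡⟨ split (at x n) (at x N) ⟩
    (at x n ℚ.- at x N) ℚ.+ at x N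
      ≤⟨ ℚₚ.+-mono-≤ (ℚₚ.≤-trans (p≤∣p∣ _) (ℚₚ.<⇒≤ (p n N N≤n ℕₚ.≤-refl)))
                     (p≤∣p∣ (at x N)) ⟩
    1ℚ ℚ.+ ℚ.∣ at x N ∣                      ∎
  where
  open ℚₚ.≤-Reasoning
  split : ∀ a b → a ≡ (a ℚ.- b) ℚ.+ b
  split = solve 2 (λ a b → a := ((a :- b) :+ b)) refl
    where open +-*-Solver

-- Let `B` eventually bound `y` from above. A late term of `x` at or below `ε / B` would bring the
-- product down to `ε`, against its margin, so `ε / B` is a margin for `x`.
Positive-⊛-cancelʳ : ∀ {x y} → Positive (x ⊛ y) → Positive y → Positive x
Positive-⊛-cancelʳ {x} {y} (pos (ε , ε>0 , L , p)) (pos (_ , δ>0 , M , q)) =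
  let (B , B>0 , N , r) = eventually-bounded y
      instance
        B-pos : ℚ.Positive B
        B-pos = ℚ.positive B>0
        B-nonZero : ℚ.NonZero B
        B-nonZero = ℚₚ.pos⇒nonZero B
        1/B-pos : ℚ.Positive (ℚ.1/ B)
        1/B-pos = ℚₚ.1/pos⇒pos B
      η = ε ℚ.* ℚ.1/ B
      ηB≡ε : η ℚ.* B ≡ ε
      ηB≡ε = trans (ℚₚ.*-assoc ε (ℚ.1/ B) B)
        (trans (cong (ε ℚ.*_) (ℚₚ.*-inverseˡ B)) (ℚₚ.*-identityʳ ε))
      η>0 = p*q>0 ε>0 (ℚₚ.positive⁻¹ (ℚ.1/ B))
  in pos (η , η>0 , L ℕ.⊔ (M ℕ.⊔ N) , λ n ≤n →
    let a = at x n
        b = at y n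
        MN≤n = ℕₚ.m⊔n≤o⇒n≤o L (M ℕ.⊔ N) ≤n
        b>0 = ℚₚ.<-trans δ>0 (subst (ℚ._< b) (ℚₚ.+-identityˡ _)
                (q n (ℕₚ.m⊔n≤o⇒m≤o M N MN≤n)))
        instance
          b-pos : ℚ.Positive b
          b-pos = ℚ.positive b>0
          b-nonNeg : ℚ.NonNegative b
          b-nonNeg = ℚₚ.pos⇒nonNeg b
          η-nonNeg : ℚ.NonNegative η
          η-nonNeg = ℚ.nonNegative (ℚₚ.<⇒≤ η>0)
    in subst (ℚ._< a) (sym (ℚₚ.+-identityˡ η)) (ℚₚ.≰⇒> λ a≤η →
      ℚₚ.<-irrefl refl (begin-strict
        ε           ≡⟨ ℚₚ.+-identityˡ ε ⟨
        0ℚ ℚ.+ ε    <⟨ p n (ℕₚ.m⊔n≤o⇒m≤o L (M ℕ.⊔ N) ≤n) ⟩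
        a ℚ.* b     ≤⟨ ℚₚ.*-monoʳ-≤-nonNeg b a≤η ⟩
        η ℚ.* b     ≤⟨ ℚₚ.*-monoˡ-≤-nonNeg η (r n (ℕₚ.m⊔n≤o⇒n≤o M N MN≤n)) ⟩
        η ℚ.* B     ≡⟨ ηB≡ε ⟩
        ε           ∎)))
  where open ℚₚ.≤-Reasoning

Positive-difference⇒< : ∀ x y → Positive (⌜ y ⌝ ⊖ ⌜ x ⌝) → x < y
Positive-difference⇒< x y (pos (ε , ε>0 , N , p)) = ε , ε>0 , N , λ n N≤n →
  subst₂ ℚ._<_ (l (seq x n) ε) (r (seq x n) (seq y n))
    (ℚₚ.+-monoʳ-< (seq x n) (p n N≤n))
  where
  open +-*-Solver
  l : ∀ a ε → a ℚ.+ (0ℚ ℚ.+ ε) ≡ a ℚ.+ ε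
  l a ε = cong (a ℚ.+_) (ℚₚ.+-identityˡ ε)
  r : ∀ a b → a ℚ.+ (b ℚ.- a) ≡ b
  r = solve 2 (λ a b → (a :+ (b :- a)) := b) refl

<-asymm : ∀ x y → x < y → ¬ (y < x)
<-asymm x y (ε , ε>0 , M , p) (δ , δ>0 , N , q) =
  let n = M ℕ.⊔ N in
  ℚₚ.<-asym (ℚₚ.<-trans (below (seq x n) ε>0) (p n (ℕₚ.m≤m⊔n M N)))
            (ℚₚ.<-trans (below (seq y n) δ>0) (q n (ℕₚ.m≤n⊔m M N)))
  where
  below : ∀ a {ε} → 0ℚ ℚ.< ε → a ℚ.< a ℚ.+ ε
  below a ε>0 = subst (ℚ._< a ℚ.+ _) (ℚₚ.+-identityʳ a) (ℚₚ.+-monoʳ-< a ε>0)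

<-irrefl : ∀ x → ¬ (x < x)
<-irrefl x x<x = <-asymm x x x<x x<x

-- The normalisation in `ℚ._/_` does not compute on a variable `n`. On unnormalised rationals both
-- denominators are 1 and the equation is one of integers.
suc/1 : ∀ n → ℤ.+ suc n ℚ./ 1 ≡ 1ℚ ℚ.+ ℤ.+ n ℚ./ 1
suc/1 n = ℚₚ.toℚᵘ-injective (begin-equality
  ℚ.toℚᵘ (ℤ.+ suc n ℚ./ 1)
    ≃⟨ ℚₚ.toℚᵘ-fromℚᵘ (ℚᵘ.mkℚᵘ (ℤ.+ suc n) 0) ⟩
  ℚᵘ.mkℚᵘ (ℤ.+ suc n) 0
    ≃⟨ ℚᵘ.*≡* (cong (λ k → (ℤ.1ℤ ℤ.+ k) ℤ.* ℤ.1ℤ) (sym (ℤₚ.*-identityʳ (ℤ.+ n)))) ⟩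
  ℚᵘ.1ℚᵘ ℚᵘ.+ ℚᵘ.mkℚᵘ (ℤ.+ n) 0
    ≃⟨ ℚᵘₚ.+-congʳ ℚᵘ.1ℚᵘ (ℚₚ.toℚᵘ-fromℚᵘ (ℚᵘ.mkℚᵘ (ℤ.+ n) 0)) ⟨
  ℚᵘ.1ℚᵘ ℚᵘ.+ ℚ.toℚᵘ (ℤ.+ n ℚ./ 1)
    ≃⟨ ℚₚ.toℚᵘ-homo-+ 1ℚ (ℤ.+ n ℚ./ 1) ⟨
  ℚ.toℚᵘ (1ℚ ℚ.+ ℤ.+ n ℚ./ 1) ∎)
  where open ℚᵘₚ.≤-Reasoning

-- Walks, distances and paths

module _ {n} (G : Graph n) where
  open Graph G

  -- Reachability quantifies over all lengths, but at a fixed length the search is finite; this is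
  -- what allows a known walk to be shortened until no shorter one exists.
  walk? : ∀ u v ℓ → Dec (Walk G u v ℓ)
  walk? u v zero    = map′ (λ { refl → [] }) (λ { [] → refl }) (u Fin.≟ v)
  walk? u v (suc ℓ) = map′ (λ { (_ , e , w) → e ∷ w }) (λ { (e ∷ w) → _ , e , w })
    (Finₚ.any? λ w → adj? u w ×-dec walk? w v ℓ)

  Reachable⇒IsDistance : ∀ {u v} → Reachable G u v → ∃[ d ] IsDistance G u v d
  Reachable⇒IsDistance {u} {v} (ℓ , w) = ℕᵢ.<-rec _ shorten ℓ w
    where
    shorten : ∀ ℓ → (∀ {m} → m ℕ.< ℓ → Walk G u v m → ∃[ d ] IsDistance G u v d) →
      Walk G u v ℓ → ∃[ d ] IsDistance G u v d
    shorten ℓ rec w with ℕₚ.anyUpTo? (walk? u v) ℓ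
    ... | yes (_ , m<ℓ , w′) = rec m<ℓ w′
    ... | no  none           = ℓ , w , λ m w′ → ℕₚ.≮⇒≥ λ m<ℓ → none (m , m<ℓ , w′)

  -- With `2 + k` vertices the two ends are always distinct, and a `Path (suc k)` is a `Cycle` that
  -- lacks only its closing edge.
  record Path (k : ℕ) : Set where
    field
      vertex   : Fin (2 ℕ.+ k) → Fin n
      distinct : Injective _≡_ _≡_ vertex
      step     : ∀ a → Adj (vertex (inject₁ a)) (vertex (suc a))

  open Path

  first last : ∀ {k} → Path k → Fin n
  first P = vertex P zero
  last {k} P = vertex P (fromℕ (suc k))

  first≢last : ∀ {k} (P : Path k) → first P ≢ last P
  first≢last P eq with () ← distinct P eq

  edge : ∀ {u v} → u ≢ v → Adj u v → Path 0
  edge {u} {v} u≢v e = record { vertex = ends ; distinct = ends-distinct ; step = λ { zero → e } }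
    where
    ends : Fin 2 → Fin n
    ends = u Vector.∷ v Vector.∷ Vector.[]
    ends-distinct : Injective _≡_ _≡_ ends
    ends-distinct {zero}     {zero}     _  = refl
    ends-distinct {zero}     {suc zero} eq = contradiction eq u≢v
    ends-distinct {suc zero} {zero}     eq = contradiction (sym eq) u≢v
    ends-distinct {suc zero} {suc zero} _  = refl

  cons : ∀ {k} p (P : Path k) → Adj p (first P) → (∀ a → p ≢ vertex P a) → Path (suc k)
  cons p P e p∉P = record
    { vertex   = p Vector.∷ vertex P
    ; distinct = λ {a} {b} → inj {a} {b}
    ; step     = λ { zero → e ; (suc a) → step P a }
    }
    where
    inj : Injective _≡_ _≡_ (p Vector.∷ vertex P)
    inj {zero}  {zero}  _  = refl
    inj {zero}  {suc b} eq = contradiction eq (p∉P b)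
    inj {suc a} {zero}  eq = contradiction (sym eq) (p∉P a)
    inj {suc a} {suc b} eq = cong suc (distinct P eq)

  opposite-inject₁ : ∀ {m} (a : Fin m) → opposite (inject₁ a) ≡ suc (opposite a)
  opposite-inject₁ zero    = refl
  opposite-inject₁ (suc a) = cong inject₁ (opposite-inject₁ a)

  opposite-injective : ∀ {m} → Injective _≡_ _≡_ (opposite {m})
  opposite-injective {_} {a} {b} eq = trans (sym (Finₚ.opposite-involutive a))
    (trans (cong opposite eq) (Finₚ.opposite-involutive b))

  -- Since `cons` extends a path at its front only, growth at the other end goes through reversal.
  reverse : ∀ {k} → Path k → Path k
  reverse P = record
    { vertex   = vertex P ∘ opposite
    ; distinct = opposite-injective ∘ distinct P
    ; step     = λ a → subst (λ b → Adj (vertex P b) (vertex P (inject₁ (opposite a))))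
        (sym (opposite-inject₁ a)) (symm (step P (opposite a)))
    }

  last-reverse : ∀ {k} (P : Path k) → last (reverse P) ≡ first P
  last-reverse P = cong (vertex P) (Finₚ.opposite-involutive zero)

  closed⇒Cycle : ∀ {k} (P : Path (suc k)) → Adj (last P) (first P) → Cycle G
  closed⇒Cycle P e = record
    { vertex = vertex P ; distinct = distinct P ; step = step P ; close = e }

-- The tree rooted at `i`

module Rooted {n} (G : Graph n) (tree : IsTree G) (i : Fin n) where
  open Graph G
  open Path

  private
    distance : ∀ v → ∃[ d ] IsDistance G v i d
    distance v = Reachable⇒IsDistance G (proj₁ tree v i)

  depth : Fin n → ℕ
  depth v = proj₁ (distance v)

  depth-isDistance : ∀ v → IsDistance G v i (depth v)
  depth-isDistance v = proj₂ (distance v)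

  depth≤ : ∀ {v ℓ} → Walk G v i ℓ → depth v ℕ.≤ ℓ
  depth≤ {v} = proj₂ (depth-isDistance v) _

  depth-adj : ∀ {u v} → Adj u v → depth u ℕ.≤ suc (depth v)
  depth-adj {v = v} e = depth≤ (e ∷ proj₁ (depth-isDistance v))

  depth≡0⇒root : ∀ v → depth v ≡ 0 → v ≡ i
  depth≡0⇒root v eq with depth v | proj₁ (depth-isDistance v)
  depth≡0⇒root v refl | .0 | [] = refl

  Parent : Fin n → Fin n → Set
  Parent v p = Adj v p × depth v ≡ suc (depth p)

  -- Take the first edge of a shortest walk to the root. The rest of the walk shows that its
  -- endpoint is at least one closer, and `depth-adj` that it is at most one closer.
  parent : ∀ v → v ≢ i → ∃[ p ] Parent v p
  parent v v≢i = go (proj₁ (depth-isDistance v)) refl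
    where
    go : ∀ {ℓ} → Walk G v i ℓ → depth v ≡ ℓ → ∃[ p ] Parent v p
    go []      _  = contradiction refl v≢i
    go (e ∷ w) eq = _ , e , ℕₚ.≤-antisym (depth-adj e)
      (subst (_ ℕ.≤_) (sym eq) (ℕ.s≤s (depth≤ w)))

  suc⇒≢root : ∀ {v d} → depth v ≡ suc d → v ≢ i
  suc⇒≢root eq refl = ℕₚ.n≮0 (ℕₚ.≤-trans (ℕₚ.≤-reflexive (sym eq)) (depth≤ []))

  -- Climbing from either end of a path whose other vertices are no closer to
  -- the root keeps it a path, until the two ends meet and close a cycle.
  mutual
    no-level-path : ∀ L {k} (P : Path G k) → depth (first G P) ≡ L → depth (last G P) ≡ L →
      (∀ a → L ℕ.≤ depth (vertex P a)) → ⊥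
    no-level-path zero    P a≡ b≡ _ = first≢last G P
      (trans (depth≡0⇒root _ a≡) (sym (depth≡0⇒root _ b≡)))
    no-level-path (suc L) P a≡ b≡ high =
      -- Reversal brings the end that is still at level `suc L` to the front, where it climbs next.
      no-slanted-path L (reverse G Q) b≡ (trans (cong depth (last-reverse G Q)) p≡L) below-last
      where
      above = parent (first G P) (suc⇒≢root a≡)
      p = proj₁ above
      p≡L : depth p ≡ L
      p≡L = ℕₚ.suc-injective (trans (sym (proj₂ (proj₂ above))) a≡)
      Q = cons G p P (symm (proj₁ (proj₂ above))) λ a p≡a →
        ℕₚ.<-irrefl (trans (sym p≡L) (cong depth p≡a)) (high a)
      below-last : ∀ a → a ≢ fromℕ _ → suc L ℕ.≤ depth (vertex (reverse G Q) a)
      below-last a a≢last with opposite a in eq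
      ... | zero  = contradiction (trans (sym (Finₚ.opposite-involutive a)) (cong opposite eq)) a≢last
      ... | suc b = high b

    no-slanted-path : ∀ L {k} (P : Path G (suc k)) →
      depth (first G P) ≡ suc L → depth (last G P) ≡ L →
      (∀ a → a ≢ fromℕ (suc (suc k)) → suc L ℕ.≤ depth (vertex P a)) → ⊥
    no-slanted-path L {k} P a≡ b≡ high with parent (first G P) (suc⇒≢root a≡)
    ... | (p , e , eq) with p Fin.≟ last G P
    -- The parent of the first end is the last vertex. A slanted path has at least three vertices,
    -- so this edge closes a genuine cycle.
    ...   | yes refl = proj₂ tree (closed⇒Cycle G P (symm e))
    ...   | no p≢b  =
      let Q = cons G p P (symm e) p∉P
      in no-level-path L (reverse G Q) b≡ (trans (cong depth (last-reverse G Q)) p≡L) all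
      where
      p≡L : depth p ≡ L
      p≡L = ℕₚ.suc-injective (trans (sym eq) a≡)
      p∉P : ∀ a → p ≢ vertex P a
      p∉P a p≡a with a Fin.≟ fromℕ (suc (suc k))
      ... | yes refl   = p≢b p≡a
      ... | no a≢last = ℕₚ.<-irrefl (trans (sym p≡L) (cong depth p≡a)) (high a a≢last)
      all : ∀ a → L ℕ.≤ depth (vertex (reverse G (cons G p P (symm e) p∉P)) a)
      all a with opposite a
      ... | zero  = ℕₚ.≤-reflexive (sym p≡L)
      ... | suc b with b Fin.≟ fromℕ (suc (suc k))
      ...   | yes refl  = ℕₚ.≤-reflexive (sym b≡)
      ...   | no b≢last = ℕₚ.<⇒≤ (high b b≢last)

  -- Depths of neighbours differ by at most one, so only equal depths need excluding, and an edge
  -- between equal depths is by itself a level path.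
  Adj⇒Parent : ∀ {u v} → Adj u v → Parent u v ⊎ Parent v u
  Adj⇒Parent {u} {v} e with ℕₚ.<-cmp (depth u) (depth v)
  ... | tri< u<v _ _ = inj₂ (symm e , ℕₚ.≤-antisym (depth-adj (symm e)) u<v)
  ... | tri> _ _ v<u = inj₁ (e , ℕₚ.≤-antisym (depth-adj e) v<u)
  ... | tri≈ _ u≡v _ = contradiction
    (λ { zero → ℕₚ.≤-refl ; (suc zero) → ℕₚ.≤-reflexive u≡v })
    (no-level-path (depth u) (edge G (λ u≡v → irrefl u≡v e) e) refl (sym u≡v))

  -- Distinct parents would be the ends of the path `p`, `v`, `q`: they have equal depth, and `v`
  -- lies one level deeper.
  parent-unique : ∀ {v p q} → Parent v p → Parent v q → p ≡ q
  parent-unique {v} {p} {q} (e , v≡1+p) (f , v≡1+q) with p Fin.≟ q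
  ... | yes p≡q = p≡q
  ... | no p≢q = contradiction
    (λ { zero → ℕₚ.≤-refl
       ; (suc zero) → ℕₚ.<⇒≤ (ℕₚ.≤-reflexive (sym v≡1+p))
       ; (suc (suc zero)) → ℕₚ.≤-reflexive p≡ₗq })
    (no-level-path (depth p) (cons G p (edge G (λ v≡q → irrefl v≡q f) f) (symm e)
       λ { zero p≡v → irrefl (sym p≡v) e ; (suc zero) → p≢q })
     refl (sym p≡ₗq))
    where
    p≡ₗq : depth p ≡ depth q
    p≡ₗq = ℕₚ.suc-injective (trans (sym v≡1+p) v≡1+q)

-- Finite sums and the Laplacian

open ≈-Reasoning
open Σ using () renaming (sum to Σ)
open CommutativeMonoid ⊕-0-commutativeMonoid using (reflexive) renaming (identityʳ to ⊕-identityʳ)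

sum-zero : ∀ {n} (f : Vector ℛ n) → (∀ a → f a ≈ 0#) → Σ f ≈ 0#
sum-zero {n} f f≈0 = ≈-trans (Σ.sum-cong-≋ f≈0) (Σ.sum-replicate-zero n)

sum-elements : ∀ {n} (C : Subset n) (f : Vector ℛ n) → (∀ a → a ∉ C → f a ≈ 0#) →
  Σ (f ∘ lookup (elements C)) ≈ Σ f
sum-elements Vec.[] f _ = ≈-refl
sum-elements (inside ∷ C) f off = ⊕-cong ≈-refl (≈-trans
  (reflexive (Σ.sum-cong-≗ λ b → cong f (Vecₚ.lookup-map b suc (elements C))))
  (sum-elements C (f ∘ suc) λ a a∉C → off (suc a) λ { (there a∈C) → a∉C a∈C }))
sum-elements (outside ∷ C) f off = begin
  Σ (f ∘ lookup (map suc (elements C)))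
    ≡⟨ Σ.sum-cong-≗ (λ b → cong f (Vecₚ.lookup-map b suc (elements C))) ⟩
  Σ (f ∘ suc ∘ lookup (elements C))
    ≈⟨ sum-elements C (f ∘ suc) (λ a a∉C → off (suc a) λ { (there a∈C) → a∉C a∈C }) ⟩
  Σ (f ∘ suc)
    ≈⟨ ⊕-identityˡ (Σ (f ∘ suc)) ⟨
  0# ⊕ Σ (f ∘ suc)
    ≈⟨ ⊕-cong (off zero λ ()) ≈-refl ⟨
  Σ f ∎

∈⇒elements : ∀ {n} {C : Subset n} {a} → a ∈ C → ∃[ b ] lookup (elements C) b ≡ a
∈⇒elements here = zero , refl
∈⇒elements {C = inside ∷ C} (there a∈C) = let (b , eq) = ∈⇒elements a∈C in
  suc b , trans (Vecₚ.lookup-map b suc (elements C)) (cong suc eq)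
∈⇒elements {C = outside ∷ C} (there a∈C) = let (b , eq) = ∈⇒elements a∈C in
  b , trans (Vecₚ.lookup-map b suc (elements C)) (cong suc eq)

sum-delta : ∀ {n} v x (y : Vector ℛ n) →
  Σ (λ u → ⌜ if does (v Fin.≟ u) then x else 0ℝ ⌝ ⊛ y u) ≈ ⌜ x ⌝ ⊛ y v
sum-delta {suc n} v x y = begin
  Σ f                            ≈⟨ Σ.sum-remove {i = v} f ⟩
  f v ⊕ Σ (f ∘ punchIn v)        ≈⟨ ⊕-cong (reflexive on) (sum-zero _ off) ⟩
  ⌜ x ⌝ ⊛ y v ⊕ 0#                     ≈⟨ ⊕-identityʳ (⌜ x ⌝ ⊛ y v) ⟩
  ⌜ x ⌝ ⊛ y v                          ∎
  where
  f : Vector ℛ (suc n)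
  f u = ⌜ if does (v Fin.≟ u) then x else 0ℝ ⌝ ⊛ y u
  on : f v ≡ ⌜ x ⌝ ⊛ y v
  on = cong (λ b → ⌜ if b then x else 0ℝ ⌝ ⊛ y v) (dec-true (v Fin.≟ v) refl)
  off : ∀ u → f (punchIn v u) ≈ 0#
  off u = ≈-trans
    (reflexive (cong (λ b → ⌜ if b then x else 0ℝ ⌝ ⊛ y (punchIn v u))
      (dec-false (v Fin.≟ punchIn v u) (Finₚ.punchInᵢ≢i v u ∘ sym))))
    (≈-pointwise λ m → ℚₚ.*-zeroˡ (at (y (punchIn v u)) m))

sum-indicator : ∀ {n} (b : Fin n → Bool) x →
  Σ (λ u → if b u then x else 0#) ≈ ⌜ fromℕ′ ∣ tabulate b ∣ ⌝ ⊛ x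
sum-indicator {zero}  b x = ≈-pointwise λ m → sym (ℚₚ.*-zeroˡ (at x m))
sum-indicator {suc n} b x = ≈-trans
  (⊕-cong ≈-refl (sum-indicator (b ∘ suc) x)) (count (b zero) (tabulate (b ∘ suc)))
  where
  count : ∀ {n} c (C : Subset n) →
    (if c then x else 0#) ⊕ ⌜ fromℕ′ ∣ C ∣ ⌝ ⊛ x ≈ ⌜ fromℕ′ ∣ c ∷ C ∣ ⌝ ⊛ x
  count true C = ≈-pointwise λ m → trans
    (factor (at x m) (ℤ.+ ∣ C ∣ ℚ./ 1))
    (cong (ℚ._* at x m) (sym (suc/1 ∣ C ∣)))
    where
    factor : ∀ y k → y ℚ.+ k ℚ.* y ≡ (1ℚ ℚ.+ k) ℚ.* y
    factor = solve 2 (λ y k → (y :+ k :* y) := ((con 1ℚ :+ k) :* y)) refl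
      where open +-*-Solver
  count false C = ⊕-identityˡ _

⌜sum⌝ : ∀ {n} (f : Vector ℝ n) → ⌜ sum f ⌝ ≈ Σ (λ a → ⌜ f a ⌝)
⌜sum⌝ {zero}  f = ≈-pointwise λ _ → refl
⌜sum⌝ {suc n} f = begin
  ⌜ sum f ⌝                         ≈⟨ ≈-pointwise (λ _ → refl) ⟩
  ⌜ f zero ⌝ ⊕ ⌜ sum (f ∘ suc) ⌝    ≈⟨ ⊕-cong ≈-refl (⌜sum⌝ (f ∘ suc)) ⟩
  Σ (λ a → ⌜ f a ⌝)                 ∎

module _ {n} (G : Graph n) (φ : Vector ℛ n) where
  open Graph G

  drop : Fin n → Fin n → ℛ
  drop v u = if does (adj? v u) then φ v ⊖ φ u else 0#

  -- The degree of `v` counts its neighbours, so the diagonal term is one copy of `φ v` per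
  -- neighbour, each paired with the `⊝ φ u` that the adjacency matrix contributes.
  laplacian-drop : ∀ v → Σ (λ u → ⌜ laplacian G v u ⌝ ⊛ φ u) ≈ Σ (drop v)
  laplacian-drop v = begin
    Σ (λ u → ⌜ laplacian G v u ⌝ ⊛ φ u)
      ≈⟨ Σ.sum-cong-≋ expand ⟩
    Σ (λ u → ⌜ degreeMatrix G v u ⌝ ⊛ φ u ⊕ toll u)
      ≈⟨ Σ.∑-distrib-+ (λ u → ⌜ degreeMatrix G v u ⌝ ⊛ φ u) toll ⟩
    Σ (λ u → ⌜ degreeMatrix G v u ⌝ ⊛ φ u) ⊕ Σ toll
      ≈⟨ ⊕-cong (sum-delta v (fromℕ′ (degree G v)) φ) ≈-refl ⟩
    ⌜ fromℕ′ (degree G v) ⌝ ⊛ φ v ⊕ Σ toll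
      ≈⟨ ⊕-cong (sum-indicator (λ u → does (adj? v u)) (φ v)) ≈-refl ⟨
    Σ (λ u → if does (adj? v u) then φ v else 0#) ⊕ Σ toll
      ≈⟨ Σ.∑-distrib-+ _ toll ⟨
    Σ (λ u → (if does (adj? v u) then φ v else 0#) ⊕ toll u)
      ≈⟨ Σ.sum-cong-≋ (λ u → collect (does (adj? v u)) (φ v) (φ u)) ⟩
    Σ (drop v) ∎
    where
    toll : Vector ℛ n
    toll u = if does (adj? v u) then ⊝ φ u else 0#
    entry : ∀ b d y m → (d ℚ.- seq (if b then 1ℝ else 0ℝ) m) ℚ.* at y m ≡
      d ℚ.* at y m ℚ.+ at (if b then ⊝ y else 0#) m
    entry true d y m = solve 2
      (λ d y → ((d :- con 1ℚ) :* y) := (d :* y :- y)) refl d (at y m)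
      where open +-*-Solver
    entry false d y m = solve 2
      (λ d y → ((d :- con 0ℚ) :* y) := (d :* y :+ con 0ℚ)) refl d (at y m)
      where open +-*-Solver
    expand : ∀ u → ⌜ laplacian G v u ⌝ ⊛ φ u ≈ ⌜ degreeMatrix G v u ⌝ ⊛ φ u ⊕ toll u
    expand u = ≈-pointwise λ m →
      entry (does (adj? v u)) (seq (degreeMatrix G v u) m) (φ u) m
    collect : ∀ b x y →
      (if b then x else 0#) ⊕ (if b then ⊝ y else 0#) ≈ (if b then x ⊖ y else 0#)
    collect true  x y = ≈-refl
    collect false x y = ⊕-identityˡ 0#

  drop-adj : ∀ {v u} → Adj v u → drop v u ≡ φ v ⊖ φ u
  drop-adj {v} {u} e = cong (λ b → if b then φ v ⊖ φ u else 0#) (dec-true (adj? v u) e)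

  drop-nonadj : ∀ {v u} → ¬ Adj v u → drop v u ≡ 0#
  drop-nonadj {v} {u} ¬e = cong (λ b → if b then φ v ⊖ φ u else 0#) (dec-false (adj? v u) ¬e)

laplacian-nonadj : ∀ {n} (G : Graph n) {v u} → v ≢ u → ¬ Graph.Adj G v u → ∀ x →
  ⌜ laplacian G v u ⌝ ⊛ x ≈ 0#
laplacian-nonadj G {v} {u} v≢u ¬e x = ≈-pointwise λ m → trans
  (cong₂ (λ p q → (seq (if p then fromℕ′ (degree G v) else 0ℝ) m ℚ.-
                   seq (if q then 1ℝ else 0ℝ) m) ℚ.* at x m)
    (dec-false (v Fin.≟ u) v≢u) (dec-false (Graph.adj? G v u) ¬e))
  (ℚₚ.*-zeroˡ (at x m))

-- An off-diagonal entry is 0 or -1, so the product is zero or `⊝ x`. This disposes of the column of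
-- the root, where `φ` vanishes only up to `_≃_`.
laplacian-offdiagonal-0 : ∀ {n} (G : Graph n) {v u x} → v ≢ u → x ≈ 0# →
  ⌜ laplacian G v u ⌝ ⊛ x ≈ 0#
laplacian-offdiagonal-0 G {v} {u} {x} v≢u x≈0 = by-cases (Graph.adj? G v u)
  where
  open +-*-Solver
  by-cases : Dec (Graph.Adj G v u) → ⌜ laplacian G v u ⌝ ⊛ x ≈ 0#
  by-cases (no ¬e) = laplacian-nonadj G v≢u ¬e x
  by-cases (yes e) = begin
    ⌜ laplacian G v u ⌝ ⊛ x  ≈⟨ ≈-pointwise (λ m → trans
      (cong₂ (λ p q → (seq (if p then fromℕ′ (degree G v) else 0ℝ) m ℚ.-
                       seq (if q then 1ℝ else 0ℝ) m) ℚ.* at x m)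
        (dec-false (v Fin.≟ u) v≢u) (dec-true (Graph.adj? G v u) e))
      (solve 1 (λ x → ((con 0ℚ :- con 1ℚ) :* x) := (:- x)) refl (at x m))) ⟩
    ⊝ x                      ≈⟨ ⊝-cong x≈0 ⟩
    ⊝ 0#                     ≈⟨ ≈-pointwise (λ _ → refl) ⟩
    0#                       ∎

-- The sign of S is decided because 0 ≤ S, a negation in this ℝ, would not
-- suffice to obtain a positive rational lower bound on φ v + S.
NonPositiveMultiple : ℛ → ℛ → Set
NonPositiveMultiple μ x = ∃[ S ] (Positive S ⊎ S ≈ 0#) × x ≈ ⊝ (μ ⊛ S)

module _ (μ : ℛ) where

  0-multiple : NonPositiveMultiple μ 0#
  0-multiple = 0# , inj₂ ≈-refl , ≈-pointwise λ m → sym (cong ℚ.-_ (ℚₚ.*-zeroʳ (at μ m)))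

  ⊕-multiple : ∀ {x y} →
    NonPositiveMultiple μ x → NonPositiveMultiple μ y → NonPositiveMultiple μ (x ⊕ y)
  ⊕-multiple {x} {y} (S , S≥0 , x≈) (T , T≥0 , y≈) = S ⊕ T , ⊕-sign S≥0 T≥0 , (begin
    x ⊕ y                    ≈⟨ ⊕-cong x≈ y≈ ⟩
    ⊝ (μ ⊛ S) ⊕ ⊝ (μ ⊛ T)    ≈⟨ ≈-pointwise (λ m → solve 3
      (λ μ S T → (:- (μ :* S) :+ :- (μ :* T)) := (:- (μ :* (S :+ T)))) refl
      (at μ m) (at S m) (at T m)) ⟩
    ⊝ (μ ⊛ (S ⊕ T))          ∎)
    where
    open +-*-Solver
    ⊕-sign : Positive S ⊎ S ≈ 0# → Positive T ⊎ T ≈ 0# → Positive (S ⊕ T) ⊎ S ⊕ T ≈ 0#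
    ⊕-sign (inj₁ S>0) (inj₁ T>0) = inj₁ (Positive-⊕ S>0 T>0)
    ⊕-sign (inj₁ S>0) (inj₂ T≈0) =
      inj₁ (Positive-resp-≈ (≈-sym (≈-trans (⊕-cong ≈-refl T≈0) (⊕-identityʳ S))) S>0)
    ⊕-sign (inj₂ S≈0) (inj₁ T>0) =
      inj₁ (Positive-resp-≈ (≈-sym (≈-trans (⊕-cong S≈0 ≈-refl) (⊕-identityˡ T))) T>0)
    ⊕-sign (inj₂ S≈0) (inj₂ T≈0) = inj₂ (≈-trans (⊕-cong S≈0 T≈0) (⊕-identityˡ 0#))

  sum-multiple : ∀ {n} (f : Vector ℛ n) →
    (∀ a → NonPositiveMultiple μ (f a)) → NonPositiveMultiple μ (Σ f)
  sum-multiple {zero}  f f≤0 = 0-multiple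
  sum-multiple {suc n} f f≤0 = ⊕-multiple (f≤0 zero) (sum-multiple (f ∘ suc) (f≤0 ∘ suc))

-- Eigenvectors and connected components

eigenvector-equation : ∀ {n} (M : Matrix n) μ x → IsEigenvector M μ x → ∀ a (f : Vector ℛ n) →
  (∀ b → f b ≈ ⌜ M a b ⌝ ⊛ ⌜ x b ⌝) → Σ f ≈ ⌜ μ ⌝ ⊛ ⌜ x a ⌝
eigenvector-equation {n} M μ x (_ , Mx≃μx) a f f≈Mx = begin
  Σ f                        ≈⟨ Σ.sum-cong-≋ {n} (λ b → ≈-trans (f≈Mx b) (≈-pointwise λ _ → refl)) ⟩
  Σ (λ b → ⌜ M a b * x b ⌝)  ≈⟨ ⌜sum⌝ (λ b → M a b * x b) ⟨
  ⌜ (M *ᵥ x) a ⌝             ≈⟨ ⟦ Mx≃μx a ⟧ ⟩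
  ⌜ μ * x a ⌝                ≈⟨ ≈-pointwise (λ _ → refl) ⟩
  ⌜ μ ⌝ ⊛ ⌜ x a ⌝            ∎

-- Checking `IsEigenvector M μ (x ∘ e)` against `IsEigenvector M μ λ a → x (e a)`
-- directly unfolds all Cauchy proofs, hence the propositional detour.
IsEigenvector-resp-≡ : ∀ {n} (M : Matrix n) μ {x} y → x ≡ y →
  IsEigenvector M μ x → IsEigenvector M μ y
IsEigenvector-resp-≡ M μ y refl p = p

∘-≡ : ∀ {m n} (e : Fin m → Fin n) (x : Fin n → ℝ) → x ∘ e ≡ (λ a → x (e a))
∘-≡ e x = refl

-- The summands `f` are left to the caller, so that they can be written in whatever form suits the
-- later sums over the whole graph.
positive-eigenvector : ∀ {m n} (M : Matrix m) (e : Fin m → Fin n) (x : Fin n → ℝ) →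
  ∃[ μ ] IsSmallestEigenvalue M μ × IsEigenvector M μ (x ∘ e) × (∀ a → 0ℝ < x (e a)) →
  ∃[ μ ] (∀ a (f : Vector ℛ m) → (∀ b → f b ≈ ⌜ M a b ⌝ ⊛ ⌜ x (e b) ⌝) →
            Σ f ≈ μ ⊛ ⌜ x (e a) ⌝) ×
         (∀ a → Positive ⌜ x (e a) ⌝)
positive-eigenvector M e x (μ , _ , x-eigenvector , x>0) =
  ⌜ μ ⌝ ,
  eigenvector-equation M μ (λ a → x (e a))
    (IsEigenvector-resp-≡ M μ (λ a → x (e a)) (∘-≡ e x) x-eigenvector) ,
  λ a → pos (x>0 a)

-- Excluded middle for reachability holds under double negation at each vertex. As there are
-- finitely many vertices, the double negation moves outside, and the resulting decisions define the
-- subset.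
¬¬-component : ∀ {n} (G : Graph n) a → ¬ ¬ (∃[ C ] IsComponent G C × a ∈ C)
¬¬-component G a = ¬¬-map build
  (Finₚ.sequence (RawMonad.rawApplicative ¬¬-Monad) {P = λ b → Dec (Reachable G a b)}
    λ _ → ¬¬-excluded-middle)
  where
  build : (∀ b → Dec (Reachable G a b)) → ∃[ C ] IsComponent G C × a ∈ C
  build reachable? = C , (a , λ b → mk⇔ to from) , from (0 , [])
    where
    C = tabulate (does ∘ reachable?)
    from : ∀ {b} → Reachable G a b → b ∈ C
    from {b} r = Vecₚ.lookup⇒[]= b C
      (trans (Vecₚ.lookup∘tabulate (does ∘ reachable?) b) (dec-true (reachable? b) r))
    to : ∀ {b} → b ∈ C → Reachable G a b
    to {b} b∈C with reachable? b
      | trans (sym (Vecₚ.lookup∘tabulate (does ∘ reachable?) b)) (Vecₚ.[]=⇒lookup b∈C)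
    ... | yes r | _ = r

snoc : ∀ {n} (G : Graph n) {u v w ℓ} → Walk G u v ℓ → Graph.Adj G v w → Walk G u w (suc ℓ)
snoc G []      e = e ∷ []
snoc G (f ∷ w) e = f ∷ snoc G w e

IsComponent-closed : ∀ {n} (G : Graph n) {C} → IsComponent G C →
  ∀ {a b} → Graph.Adj G a b → a ∈ C → b ∈ C
IsComponent-closed G (_ , C⇔) {a} {b} e a∈C =
  let (_ , w) = Equivalence.to (C⇔ a) a∈C in Equivalence.from (C⇔ b) (_ , snoc G w e)

-- Growth of `φ` away from the root

module Potential {n} (G : Graph (suc n)) (tree : IsTree G) (i : Fin (suc n))
  (φ : Vector ℝ (suc n)) (φ-isPotential : IsPotential G i φ) where
  open Graph G
  open Rooted G tree i
  open IsPotential φ-isPotential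

  ϕ : Vector ℛ (suc n)
  ϕ v = ⌜ φ v ⌝

  module _ {C : Subset n} (C-isComponent : IsComponent (G ∖ i) C) where

    private
      eigendata = positive-eigenvector (componentLaplacian G i C) (componentVertex G i C) φ
        (component C C-isComponent)

    μ : ℛ
    μ = proj₁ eigendata

    -- Membership is recorded by a row index of the submatrix: this is where the eigenvector
    -- equation and the positivity of `φ` are available.
    InC : Fin (suc n) → Set
    InC v = ∃[ b ] componentVertex G i C b ≡ v

    ∈⇒InC : ∀ {a} → a ∈ C → InC (punchIn i a)
    ∈⇒InC a∈C = let (b , eq) = ∈⇒elements a∈C in b , cong (punchIn i) eq

    InC⇒∈ : ∀ {a} → InC (punchIn i a) → a ∈ C
    InC⇒∈ (b , eq) = subst (_∈ C) (Finₚ.punchIn-injective i _ _ eq) (elements⇒∈ C b)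
      where
      elements⇒∈ : ∀ {n} (C : Subset n) b → lookup (elements C) b ∈ C
      elements⇒∈ (inside  ∷ C) zero    = here
      elements⇒∈ (inside  ∷ C) (suc b) =
        subst (_∈ inside ∷ C) (sym (Vecₚ.lookup-map b suc (elements C))) (there (elements⇒∈ C b))
      elements⇒∈ (outside ∷ C) b =
        subst (_∈ outside ∷ C) (sym (Vecₚ.lookup-map b suc (elements C))) (there (elements⇒∈ C b))

    InC⇒≢root : ∀ {v} → InC v → v ≢ i
    InC⇒≢root (_ , refl) = Finₚ.punchInᵢ≢i i _

    -- A component of `G ∖ i` can be left only through `i`.
    InC-closed : ∀ {u v} → Adj u v → v ≢ i → InC u → InC v
    InC-closed {u} {v} e v≢i u∈C = subst InC v≡ (∈⇒InC
      (IsComponent-closed (G ∖ i) C-isComponent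
        (subst₂ Adj (sym u≡) (sym v≡) e) (InC⇒∈ (subst InC (sym u≡) u∈C))))
      where
      u≡ = Finₚ.punchIn-punchOut (InC⇒≢root u∈C ∘ sym)
      v≡ = Finₚ.punchIn-punchOut (v≢i ∘ sym)

    φ-positive : ∀ {v} → InC v → Positive (ϕ v)
    φ-positive (b , refl) = proj₂ (proj₂ eigendata) b

    inner-term : Fin (suc n) → Fin ∣ C ∣ → ℛ
    inner-term v b = ⌜ laplacian G v (punchIn i (lookup (elements C) b)) ⌝ ⊛
      ϕ (punchIn i (lookup (elements C) b))

    -- The column of `i` contributes nothing because `φ` is zero there, and a vertex outside both
    -- `C` and the root is not adjacent to `v`.
    sum-over-component : ∀ {v} → InC v →
      Σ (λ u → ⌜ laplacian G v u ⌝ ⊛ ϕ u) ≈ Σ (inner-term v)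
    sum-over-component {v} v∈C = begin
      Σ term
        ≈⟨ Σ.sum-remove {i = i} term ⟩
      term i ⊕ Σ (term ∘ punchIn i)
        ≈⟨ ⊕-cong (laplacian-offdiagonal-0 G {v} {i} (InC⇒≢root v∈C) ⟦ root ⟧) ≈-refl ⟩
      0# ⊕ Σ (term ∘ punchIn i)
        ≈⟨ ⊕-identityˡ _ ⟩
      Σ (term ∘ punchIn i)
        ≈⟨ sum-elements C (term ∘ punchIn i) outside-C ⟨
      Σ (inner-term v) ∎
      where
      term : Vector ℛ (suc n)
      term u = ⌜ laplacian G v u ⌝ ⊛ ϕ u
      outside-C : ∀ a → a ∉ C → term (punchIn i a) ≈ 0#
      outside-C a a∉C = laplacian-nonadj G {v} {punchIn i a}
        (λ v≡a → a∉C (InC⇒∈ (subst InC v≡a v∈C)))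
        (λ e → a∉C (InC⇒∈ (InC-closed e (Finₚ.punchInᵢ≢i i a) v∈C)))
        (ϕ (punchIn i a))

    inner-eigenvalue-equation : ∀ b → Σ (inner-term (componentVertex G i C b)) ≈
      μ ⊛ ϕ (componentVertex G i C b)
    inner-eigenvalue-equation b =
      proj₁ (proj₂ eigendata) b (inner-term (componentVertex G i C b)) λ a → ≈-pointwise λ _ → refl

    eigenvalue-equation : ∀ {v} → InC v → Σ (λ u → ⌜ laplacian G v u ⌝ ⊛ ϕ u) ≈ μ ⊛ ϕ v
    eigenvalue-equation {v} v∈C = begin
      Σ (λ u → ⌜ laplacian G v u ⌝ ⊛ ϕ u)  ≈⟨ sum-over-component {v} v∈C ⟩
      Σ (inner-term v)                     ≈⟨ subst (λ v → Σ (inner-term v) ≈ μ ⊛ ϕ v)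
                                                (proj₂ v∈C) (inner-eigenvalue-equation (proj₁ v∈C)) ⟩
      μ ⊛ ϕ v                              ∎

    -- S is the sum of φ over the subtree hanging from v.
    gradient : ∀ {D} → (∀ u → depth u ℕ.≤ D) → ∀ k {v p} → D ℕ.< k ℕ.+ depth v →
      InC v → Parent v p → ∃[ S ] Positive S × ϕ v ⊖ ϕ p ≈ μ ⊛ S
    -- `k` bounds the number of levels still possible from `v` downwards; with none left, `v` would
    -- be deeper than `D`.
    gradient D-bound zero {v} D<v _ _ = contradiction (D-bound v) (ℕₚ.<⇒≱ D<v)
    gradient {D} D-bound (suc k) {v} {p} D< v∈C v↑p@(e , _) =
      ϕ v ⊕ T , positive T≥0 , (begin
        ϕ v ⊖ ϕ p
          ≡⟨ drop-adj G ϕ e ⟨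
        drop G ϕ v p
          -- Adding and subtracting the drops to all other vertices completes the Laplacian sum at
          -- `v`, to which the eigenvalue equation applies.
          ≈⟨ ≈-pointwise (λ m → insert (at (drop G ϕ v p) m) (at others m)) ⟩
        (drop G ϕ v p ⊕ others) ⊖ others
          ≈⟨ ⊕-cong (≈-sym (Σ.sum-remove {i = p} (drop G ϕ v))) (⊝-cong others≈) ⟩
        Σ (drop G ϕ v) ⊖ ⊝ (μ ⊛ T)
          ≈⟨ ⊕-cong (≈-trans (≈-sym (laplacian-drop G ϕ v)) (eigenvalue-equation v∈C)) ≈-refl ⟩
        μ ⊛ ϕ v ⊖ ⊝ (μ ⊛ T)
          ≈⟨ ≈-pointwise (λ m → factor (at μ m) (seq (φ v) m) (at T m)) ⟩
        μ ⊛ (ϕ v ⊕ T) ∎)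
      where
      child : ∀ u → u ≢ p → Dec (Adj v u) → NonPositiveMultiple μ (drop G ϕ v u)
      child u u≢p (no ¬e) = subst (NonPositiveMultiple μ) (sym (drop-nonadj G ϕ ¬e)) (0-multiple μ)
      child u u≢p (yes e) with Adj⇒Parent e
      ... | inj₁ v↑u = contradiction (parent-unique v↑u v↑p) u≢p
      ... | inj₂ u↑v@(_ , deeper) =
        let (S , S>0 , eq) = gradient D-bound k
              -- A child spends one unit of `k` and gains one of depth, so `k + depth` does not
              -- change.
              (subst (D ℕ.<_) (trans (sym (ℕₚ.+-suc k (depth v))) (cong (k ℕ.+_) (sym deeper))) D<)
              (InC-closed e (suc⇒≢root deeper) v∈C) u↑v
        in S , inj₁ S>0 , (begin
          drop G ϕ v u     ≡⟨ drop-adj G ϕ e ⟩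
          ϕ v ⊖ ϕ u        ≈⟨ ≈-pointwise (λ m → negate (seq (φ v) m) (seq (φ u) m)) ⟩
          ⊝ (ϕ u ⊖ ϕ v)    ≈⟨ ⊝-cong eq ⟩
          ⊝ (μ ⊛ S)        ∎)
        where
        open +-*-Solver
        negate : ∀ a b → a ℚ.- b ≡ ℚ.- (b ℚ.- a)
        negate = solve 2 (λ a b → (a :- b) := (:- (b :- a))) refl
      others : ℛ
      others = Σ (drop G ϕ v ∘ punchIn p)
      others-multiple : NonPositiveMultiple μ others
      others-multiple = sum-multiple μ (drop G ϕ v ∘ punchIn p) λ a →
        child (punchIn p a) (Finₚ.punchInᵢ≢i p a) (adj? v (punchIn p a))
      T : ℛ
      T = proj₁ others-multiple
      T≥0 : Positive T ⊎ T ≈ 0#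
      T≥0 = proj₁ (proj₂ others-multiple)
      others≈ : others ≈ ⊝ (μ ⊛ T)
      others≈ = proj₂ (proj₂ others-multiple)
      positive : Positive T ⊎ T ≈ 0# → Positive (ϕ v ⊕ T)
      positive (inj₁ T>0) = Positive-⊕ (φ-positive v∈C) T>0
      positive (inj₂ T≈0) = Positive-resp-≈
        (≈-sym (≈-trans (⊕-cong ≈-refl T≈0) (⊕-identityʳ (ϕ v)))) (φ-positive v∈C)
      open +-*-Solver
      insert : ∀ a b → a ≡ (a ℚ.+ b) ℚ.- b
      insert = solve 2 (λ a b → a := ((a :+ b) :- b)) refl
      factor : ∀ μ x T → μ ℚ.* x ℚ.- (ℚ.- (μ ℚ.* T)) ≡ μ ℚ.* (x ℚ.+ T)
      factor = solve 3 (λ μ x T → (μ :* x :- (:- (μ :* T))) := (μ :* (x :+ T))) refl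

    parent-gradient : ∀ {v p} → InC v → Parent v p → ∃[ S ] Positive S × ϕ v ⊖ ϕ p ≈ μ ⊛ S
    parent-gradient = let (D , D-bound) = bounded depth in
      gradient D-bound (suc D) (ℕₚ.m≤m+n (suc D) _)
      where
      bounded : ∀ {m} (f : Fin m → ℕ) → ∃[ D ] ∀ a → f a ℕ.≤ D
      bounded {zero}  f = 0 , λ ()
      bounded {suc m} f = let (D , f≤D) = bounded (f ∘ suc) in
        f zero ℕ.⊔ D , λ { zero → ℕₚ.m≤m⊔n (f zero) D
                         ; (suc a) → ℕₚ.≤-trans (f≤D a) (ℕₚ.m≤n⊔m (f zero) D) }

    -- Climbing from `v` stays in the component until the parent is `i`. At that last vertex the
    -- gradient is its own value of `φ`, a positive number equal to `μ` times a positive sum.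
    μ-positive : ∀ d {v} → depth v ≡ d → InC v → Positive μ
    μ-positive zero    {v} eq v∈C = contradiction (depth≡0⇒root v eq) (InC⇒≢root v∈C)
    μ-positive (suc d) {v} eq v∈C with parent v (InC⇒≢root v∈C)
    ... | (p , v↑p@(e , v≡1+p)) with p Fin.≟ i
    ...   | no p≢i = μ-positive d (ℕₚ.suc-injective (trans (sym v≡1+p) eq)) (InC-closed e p≢i v∈C)
    ...   | yes refl = let (S , S>0 , φv≈μS) = parent-gradient v∈C v↑p in
      Positive-⊛-cancelʳ (Positive-resp-≈ (begin
        ϕ v          ≈⟨ ≈-pointwise (λ m → ℚₚ.+-identityʳ (seq (φ v) m)) ⟨
        ϕ v ⊖ 0#     ≈⟨ ⊕-cong ≈-refl (⊝-cong ⟦ root ⟧) ⟨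
        ϕ v ⊖ ϕ p    ≈⟨ φv≈μS ⟩
        μ ⊛ S        ∎) (φ-positive v∈C)) S>0

    parent-lower : ∀ {v p} → InC v → Parent v p → Positive (ϕ v ⊖ ϕ p)
    parent-lower v∈C v↑p = let (S , S>0 , eq) = parent-gradient v∈C v↑p in
      Positive-resp-≈ (≈-sym eq) (Positive-⊛ (μ-positive _ refl v∈C) S>0)

    -- A neighbour other than the parent is a child, two levels below `p`, so two positive
    -- differences add up along `u`, `v`, `p`.
    component-parent-lowest : ∀ {v p u} → InC v → Parent v p → Adj v u → u ≢ p → φ p < φ u
    component-parent-lowest {v} {p} {u} v∈C v↑p e u≢p with Adj⇒Parent e
    ... | inj₁ v↑u = contradiction (parent-unique v↑u v↑p) u≢p
    ... | inj₂ u↑v@(_ , deeper) = Positive-difference⇒< (φ p) (φ u) (Positive-resp-≈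
      (≈-pointwise λ m → telescope (seq (φ u) m) (seq (φ v) m) (seq (φ p) m))
      (Positive-⊕ (parent-lower (InC-closed e (suc⇒≢root deeper) v∈C) u↑v) (parent-lower v∈C v↑p)))
      where
      telescope : ∀ a b c → (a ℚ.- b) ℚ.+ (b ℚ.- c) ≡ a ℚ.- c
      telescope = solve 3 (λ a b c → ((a :- b) :+ (b :- c)) := (a :- c)) refl
        where open +-*-Solver

  -- The component of v is only obtained under double negation; this suffices, as
  -- the descent rule only involves the negative relation _≤_.
  parent-lowest : ∀ {v p u} → Parent v p → Adj v u → u ≢ p → ¬ ¬ (φ p < φ u)
  parent-lowest {v} v↑p@(_ , v≡1+p) e u≢p = ¬¬-map
    (λ { (C , C-isComponent , a∈C) → component-parent-lowest C-isComponent
         (subst (InC C-isComponent) (Finₚ.punchIn-punchOut i≢v) (∈⇒InC C-isComponent a∈C))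
         v↑p e u≢p })
    (¬¬-component (G ∖ i) (punchOut i≢v))
    where
    i≢v : i ≢ v
    i≢v = suc⇒≢root v≡1+p ∘ sym

  parent-isMinimalNeighbour : ∀ {v p} → Parent v p → IsMinimalNeighbour G φ v p
  parent-isMinimalNeighbour {v} {p} v↑p@(e , _) = e , minimal
    where
    minimal : ∀ u → Adj v u → φ p ≤ φ u
    minimal u f φu<φp with u Fin.≟ p
    ... | yes refl = <-irrefl (φ p) φu<φp
    ... | no u≢p   = parent-lowest v↑p f u≢p λ φp<φu → <-asymm (φ p) (φ u) φp<φu φu<φp

  -- Descents follow parents, however ties are broken

  minimalNeighbour-isParent : ∀ {v w} → v ≢ i → IsMinimalNeighbour G φ v w → Parent v w
  minimalNeighbour-isParent {v} {w} v≢i (e , minimal) with parent v v≢i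
  ... | (p , v↑p@(f , _)) with w Fin.≟ p
  ...   | yes refl = v↑p
  -- The parent is itself a neighbour, so minimality of `w` gives `φ w ≤ φ p`, against the strict
  -- minimality of the parent.
  ...   | no w≢p   = contradiction (minimal p f) (parent-lowest v↑p e w≢p)

  -- The value at `i` is a filler that makes the function total; a descent is unconstrained once it
  -- has reached the root.
  climb : Fin (suc n) → Fin (suc n)
  climb v with v Fin.≟ i
  ... | yes _   = i
  ... | no v≢i = proj₁ (parent v v≢i)

  climb-parent : ∀ v → v ≢ i → Parent v (climb v)
  climb-parent v v≢i with v Fin.≟ i
  ... | yes v≡i = contradiction v≡i v≢i
  ... | no v≢i′ = proj₂ (parent v v≢i′)

  descent-exists : ∀ j → ∃[ x ] IsDescent G φ i j x
  descent-exists j = x , refl , λ k before →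
    parent-isMinimalNeighbour (climb-parent (x k) (before k ℕₚ.≤-refl))
    where
    x : ℕ → Fin (suc n)
    x zero    = j
    x (suc k) = climb (x k)

  module _ {j x} (x-isDescent : IsDescent G φ i j x) where

    -- The root has depth 0, so meeting it at time `k` would turn the invariant into `k ≡ depth j`.
    above-root : ∀ {k} → k ℕ.+ depth (x k) ≡ depth j → k ℕ.< depth j → x k ≢ i
    above-root {k} eq k<d xk≡i = ℕₚ.<-irrefl (trans
      (sym (trans (cong (λ v → k ℕ.+ depth v) xk≡i)
        (trans (cong (k ℕ.+_) (ℕₚ.n≤0⇒n≡0 (depth≤ []))) (ℕₚ.+-identityʳ k))))
      eq) k<d

    climbs : ∀ {k} → (∀ {m} → m ℕ.≤ k → m ℕ.+ depth (x m) ≡ depth j) → k ℕ.< depth j →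
      Parent (x k) (x (suc k))
    climbs {k} depths k<d = minimalNeighbour-isParent
      (above-root (depths ℕₚ.≤-refl) k<d)
      (proj₂ x-isDescent k λ m m≤k → above-root (depths m≤k) (ℕₚ.≤-<-trans m≤k k<d))

    -- The invariant is proved for all `m ≤ k` together because the descent rule binds step `k` only
    -- when no earlier term, nor `x k` itself, is the root.
    descent-depth : ∀ k → k ℕ.≤ depth j → ∀ {m} → m ℕ.≤ k → m ℕ.+ depth (x m) ≡ depth j
    descent-depth zero    _   ℕ.z≤n = cong depth (proj₁ x-isDescent)
    descent-depth (suc k) k<d m≤1+k with ℕₚ.m≤n⇒m<n∨m≡n m≤1+k
    ... | inj₁ (ℕ.s≤s m≤k) = descent-depth k (ℕₚ.<⇒≤ k<d) m≤k
    ... | inj₂ refl        = let depths = descent-depth k (ℕₚ.<⇒≤ k<d) in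
      trans (sym (ℕₚ.+-suc k _))
        (trans (cong (k ℕ.+_) (sym (proj₂ (climbs depths k<d)))) (depths ℕₚ.≤-refl))

    descent-before : ∀ k → k ℕ.< depth j → x k ≢ i
    descent-before k k<d = above-root (descent-depth k (ℕₚ.<⇒≤ k<d) ℕₚ.≤-refl) k<d

    descent-shortest : IsShortestPath G j i x (depth j)
    descent-shortest = record
      { start    = proj₁ x-isDescent
      -- At time `depth j` the invariant leaves depth zero.
      ; end      = depth≡0⇒root _ (ℕₚ.+-cancelˡ-≡ (depth j) _ _
                     (trans (descent-depth (depth j) ℕₚ.≤-refl ℕₚ.≤-refl) (sym (ℕₚ.+-identityʳ (depth j)))))
      ; step     = λ k k<d → proj₁ (climbs (descent-depth k (ℕₚ.<⇒≤ k<d)) k<d)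
      ; shortest = depth-isDistance j
      }

theorem2 : ∀ {n} (G : Graph (suc n)) → IsTree G →
    (i : Fin (suc n)) (φ : Fin (suc n) → ℝ) → IsPotential G i φ →
    (j : Fin (suc n)) →
    (∃[ x ] IsDescent G φ i j x) ×
    (∀ x → IsDescent G φ i j x →
    ∃[ ℓ ] (∀ k → k ℕ.< ℓ → x k ≢ i) × IsShortestPath G j i x ℓ)
theorem2 G tree i φ φ-isPotential j =
  descent-exists j , λ x d → depth j , descent-before d , descent-shortest d
  where
  open Rooted G tree i using (depth)
  open Potential G tree i φ φ-isPotential
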